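{- Let $G$ be a tree with at least one edge, regarded as a bipartite graph with its bipartition. Then $G$ is constructible by conditioning. In particular, if $G$ is interpreted as a two-prover question set, then it admits exponential parallel repetition.
   Context: A bipartite graph $(X,Y,E)$ with $E\subseteq X\times Y$ is viewed as a 2-partite hypergraph (and as a two-prover question set $E\subseteq X\times Y$, with $Q^{(1)}=X$, $Q^{(2)}=Y$), where every vertex lies in some edge. A homomorphism $(X,Y,E)\to(X',Y',E')$ is a pair of maps $X\to X'$, $Y\to Y'$ mapping edges to edges. For $X_0\subseteq X,Y_0\subseteq Y$ the induced subgraph is $(X_0,Y_0,E\cap(X_0\times Y_0))$. Constructible by conditioning (recursively, up to renaming of vertices): (1) A single edge is constructible. (2) Doubling: given a constructible graph whose vertices are partitioned into "fixed" and "old" vertices, add for every old vertex $q$ a fresh copy $q'$ on the same side, and for every edge $e$ not both of whose endpoints are fixed add the edge $e'$ obtained by replacing each old endpoint by its copy; the result is constructible. (3) Collapse: if $H$ is constructible, $H_0$ is an induced subgraph of $H$, and some homomorphism $H\to H_0$ is the identity on the vertices of $H_0$, then $H_0$ is constructible. Games: a two-prover game with question set $E$ is $(E,A^{(1)}\times A^{(2)},V)$, $V:E\times A^{(1)}\times A^{(2)}\to\{0,1\}$; its value is the maximum over strategies $\mathcal{S}^{(1)}:X\to A^{(1)}$, $\mathcal{S}^{(2)}:Y\to A^{(2)}$ of the probability over uniform $(x,y)\in E$ that $V$ accepts $(x,y,\mathcal{S}^{(1)}(x),\mathcal{S}^{(2)}(y))$; trivial if value 1. $\mathcal{G}^n$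 has question set $E^n$, answer alphabets $(A^{(j)})^n$, accepts iff all coordinates accept. $\omega_E(n)$ is the supremum of $\mathrm{val}(\mathcal{G}^n)$ over non-trivial games with question set $E$; exponential parallel repetition means $\omega_E(n)\le C^n$ for all $n$ for some $C<1$. -}

module Defs where

open import Data.Nat using (ℕ; suc)
open import Data.Fin using (Fin; zero; suc; inject₁; fromℕ)
open import Data.Bool using (Bool; T; not)
open import Data.Unit using (⊤)
open import Data.Empty using (⊥)
open import Data.Sum using (_⊎_; inj₁; inj₂)
open import Data.Product using (Σ; ∃; ∃-syntax; _×_; _,_; proj₁)
open import Function.Bundles using (_↔_; Inverse)
open import Function.Definitions using (Injective)
open import Relation.Nullary using (¬_)
open import Relation.Binary.PropositionalEquality using (_≡_)
open import Relation.Binary.Construct.Closure.ReflexiveTransitive using (Star)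

-- Bipartite graphs (X , Y , E) with E ⊆ X × Y, vertex sets arbitrary types
-- (constructible graphs are automatically finite).

record BGraph : Set₁ where
  constructor bgraph
  field
    X : Set
    Y : Set
    E : X → Y → Set
open BGraph public

record Iso (G H : BGraph) : Set where
  field
    fX : X G ↔ X H
    fY : Y G ↔ Y H
    edge⇒ : ∀ x y → E G x y → E H (Inverse.to fX x) (Inverse.to fY y)
    edge⇐ : ∀ x y → E H (Inverse.to fX x) (Inverse.to fY y) → E G x y

singleEdge : BGraph
singleEdge = bgraph ⊤ ⊤ (λ _ _ → ⊤)

-- FX / FY mark the fixed vertices; the others are old.
-- New vertices: the old ones (inj₁) and a fresh copy of each old vertex (inj₂).
-- For each edge e not both of whose endpoints are fixed we add e', obtained
-- by replacing each old endpoint by its copy.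
double : (G : BGraph) (FX : X G → Bool) (FY : Y G → Bool) → BGraph
double G FX FY = bgraph X' Y' E'
  where
  X' = X G ⊎ Σ (X G) (λ x → T (not (FX x)))
  Y' = Y G ⊎ Σ (Y G) (λ y → T (not (FY y)))
  E' : X' → Y' → Set
  E' (inj₁ x)       (inj₁ y)       = E G x y
  E' (inj₂ (x , _)) (inj₂ (y , _)) = E G x y
  E' (inj₂ (x , _)) (inj₁ y)       = E G x y × T (FY y)
  E' (inj₁ x)       (inj₂ (y , _)) = E G x y × T (FX x)

induced : (G : BGraph) (PX : X G → Bool) (PY : Y G → Bool) → BGraph
induced G PX PY =
  bgraph (Σ (X G) (λ x → T (PX x))) (Σ (Y G) (λ y → T (PY y))) (λ x y → E G (proj₁ x) (proj₁ y))

record Hom (G H : BGraph) : Set where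
  field
    hX : X G → X H
    hY : Y G → Y H
    hE : ∀ x y → E G x y → E H (hX x) (hY y)
open Hom public

Retraction : (G : BGraph) (PX : X G → Bool) (PY : Y G → Bool) → Set
Retraction G PX PY =
  Σ (Hom G (induced G PX PY)) λ h →
    (∀ (x : X G) (p : T (PX x)) → proj₁ (hX h x) ≡ x) ×
    (∀ (y : Y G) (p : T (PY y)) → proj₁ (hY h y) ≡ y)

data Constructible : BGraph → Set₁ where
  c-edge     : Constructible singleEdge
  c-double   : ∀ {G} → Constructible G →
               (FX : X G → Bool) (FY : Y G → Bool) →
               Constructible (double G FX FY)
  c-collapse : ∀ {G} → Constructible G →
               (PX : X G → Bool) (PY : Y G → Bool) →
               Retraction G PX PY →
               Constructible (induced G PX PY)
  c-rename   : ∀ {G H} → Constructible G → Iso G H → Constructible H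

Vtx : ℕ → ℕ → Set
Vtx m k = Fin m ⊎ Fin k

Adj : ∀ {m k} → (Fin m → Fin k → Bool) → Vtx m k → Vtx m k → Set
Adj E (inj₁ x) (inj₂ y) = T (E x y)
Adj E (inj₂ y) (inj₁ x) = T (E x y)
Adj E (inj₁ _) (inj₁ _) = ⊥
Adj E (inj₂ _) (inj₂ _) = ⊥

Connected : ∀ {m k} → (Fin m → Fin k → Bool) → Set
Connected {m} {k} E = ∀ (u v : Vtx m k) → Star (Adj E) u v

-- a cycle: l+3 pairwise distinct vertices c₀ … c_{l+2}, consecutive ones
-- adjacent and c_{l+2} adjacent to c₀
HasCycle : ∀ {m k} → (Fin m → Fin k → Bool) → Set
HasCycle {m} {k} E =
  ∃[ l ] Σ (Fin (suc (suc (suc l))) → Vtx m k) λ c →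
    Injective _≡_ _≡_ c ×
    (∀ (i : Fin (suc (suc l))) → Adj E (c (inject₁ i)) (c (suc i))) ×
    Adj E (c (fromℕ (suc (suc l)))) (c zero)

IsTree : ∀ {m k} → (Fin m → Fin k → Bool) → Set
IsTree E = Connected E × ¬ HasCycle E

HasEdge : ∀ {m k} → (Fin m → Fin k → Bool) → Set
HasEdge {m} {k} E = Σ (Fin m) λ x → Σ (Fin k) λ y → T (E x y)

toBGraph : ∀ m k → (Fin m → Fin k → Bool) → BGraph
toBGraph m k E = bgraph (Fin m) (Fin k) (λ x y → T (E x y))

{-# OPTIONS --safe #-}
module Submission where

-- A tree is grown from one of its edges by attaching one pendant vertex at a
-- time, and attaching a pendant vertex to a constructible graph keeps it
-- constructible (one doubling followed by one collapse).  Acyclicity is what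
-- makes every step a pendant attachment: a vertex outside the part S grown so
-- far has at most one neighbour in S, since two neighbours would close a
-- cycle through the simple path joining them inside S.  Pendant vertices on
-- the Y side are reduced to the X side by transposing, which preserves
-- constructibility.

open import Defs
open import Data.Nat using (ℕ)
open import Data.Fin using (Fin; inject₁; fromℕ; zero; suc)
import Data.Fin as Fin
open import Data.Bool using (Bool; true; false; T; _∨_)
open import Data.Bool.Properties using (T-irrelevant; T?)
open import Data.Empty using (⊥-elim)
open import Data.List using (List; []; _∷_; _++_; [_]; length; lookup; map; allFin)
open import Data.List.Membership.Propositional using (_∈_)
open import Data.List.Membership.Propositional.Properties using (∈-allFin; ∈-map⁺; ∈-++⁺ˡ; ∈-++⁺ʳ; ∈-lookup)
open import Data.List.Relation.Unary.All as All using (All; []; _∷_)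
import Data.List.Relation.Unary.All.Properties as All
open import Data.List.Relation.Unary.AllPairs using ([]; _∷_)
import Data.List.Relation.Unary.AllPairs.Properties as AllPairs
open import Data.List.Relation.Unary.Unique.Propositional using (Unique)
open import Data.Maybe using (Maybe; just; nothing)
open import Data.Product using (Σ; ∃; _×_; _,_; proj₁)
import Data.Product.Properties as Σ
open import Data.Sum using (_⊎_; inj₁; inj₂)
open import Data.Sum.Properties using (inj₁-injective; inj₂-injective; ≡-dec)
open import Data.Unit using (tt)
open import Function using (_∘_; flip; id)
open import Function.Bundles using (mk↔ₛ′)
open import Function.Construct.Identity using (↔-id)
open import Relation.Binary.Definitions using (DecidableEquality)
open import Relation.Binary.PropositionalEquality using (_≡_; _≢_; refl; sym; cong; subst)
open import Relation.Binary.Construct.Closure.ReflexiveTransitive using (Star; ε; _◅_)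
open import Relation.Nullary using (¬_; yes; no; does)
open import Relation.Nullary.Decidable using (⌊_⌋; toWitness; fromWitness)
open import Relation.Unary using (_⊆_)

Σ-T-≡ : ∀ {A : Set} {P : A → Bool} {x y : A} {p : T (P x)} {q : T (P y)} →
        x ≡ y → _≡_ {A = Σ A (T ∘ P)} (x , p) (y , q)
Σ-T-≡ refl = cong (_ ,_) (T-irrelevant _ _)

Σ-T-≟ : ∀ {A : Set} {P : A → Bool} → DecidableEquality A → DecidableEquality (Σ A (T ∘ P))
Σ-T-≟ _≟_ = Σ.≡-dec _≟_ (λ p q → yes (T-irrelevant p q))

module _ {A : Set} (_≟_ : DecidableEquality A) where

  -- `does` rather than `⌊_⌋`, so that inserting into a subset of a sum
  -- type computes to inserting on one side.
  insert : A → (A → Bool) → A → Bool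
  insert w P x = does (x ≟ w) ∨ P x

  insert-here : ∀ P w → T (insert w P w)
  insert-here _ w with w ≟ w
  ... | yes _   = tt
  ... | no w≢w = ⊥-elim (w≢w refl)

  insert-there : ∀ P w {x} → T (P x) → T (insert w P x)
  insert-there _ w {x} p with x ≟ w
  ... | yes _ = tt
  ... | no _  = p

  insert-case : ∀ P w {x} → T (insert w P x) → x ≡ w ⊎ T (P x)
  insert-case _ w {x} p with x ≟ w
  ... | yes x≡w = inj₁ x≡w
  ... | no _    = inj₂ p

transpose : BGraph → BGraph
transpose G = bgraph (Y G) (X G) (flip (E G))

Iso-transpose : ∀ {G H} → Iso G H → Iso (transpose G) (transpose H)
Iso-transpose i = record
  { fX = Iso.fY i ; fY = Iso.fX i
  ; edge⇒ = λ y x → Iso.edge⇒ i x y ; edge⇐ = λ y x → Iso.edge⇐ i x y }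

Retraction-transpose : ∀ {G PX PY} → Retraction G PX PY → Retraction (transpose G) PY PX
Retraction-transpose (h , fixX , fixY) =
  record { hX = hY h ; hY = hX h ; hE = λ y x → hE h x y } , fixY , fixX

double-transpose : ∀ G FX FY → Iso (double (transpose G) FY FX) (transpose (double G FX FY))
double-transpose G FX FY = record { fX = ↔-id _ ; fY = ↔-id _ ; edge⇒ = swap⇒ ; edge⇐ = swap⇐ }
  where
  swap⇒ : ∀ y x → E (double (transpose G) FY FX) y x → E (double G FX FY) x y
  swap⇒ (inj₁ _) (inj₁ _) e = e
  swap⇒ (inj₁ _) (inj₂ _) e = e
  swap⇒ (inj₂ _) (inj₁ _) e = e
  swap⇒ (inj₂ _) (inj₂ _) e = e
  swap⇐ : ∀ y x → E (double G FX FY) x y → E (double (transpose G) FY FX) y x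
  swap⇐ (inj₁ _) (inj₁ _) e = e
  swap⇐ (inj₁ _) (inj₂ _) e = e
  swap⇐ (inj₂ _) (inj₁ _) e = e
  swap⇐ (inj₂ _) (inj₂ _) e = e

constructible-transpose : ∀ {G} → Constructible G → Constructible (transpose G)
constructible-transpose c-edge = c-edge
constructible-transpose (c-double {G} c FX FY) =
  c-rename (c-double (constructible-transpose c) FY FX) (double-transpose G FX FY)
constructible-transpose (c-collapse c PX PY r) =
  c-collapse (constructible-transpose c) PY PX (Retraction-transpose r)
constructible-transpose (c-rename c i) = c-rename (constructible-transpose c) (Iso-transpose i)

addLeafX : (G : BGraph) → Y G → BGraph
addLeafX G s = bgraph (Maybe (X G)) (Y G) edge
  where
  edge : Maybe (X G) → Y G → Set
  edge nothing  y = y ≡ s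
  edge (just x) y = E G x y

-- Double G keeping only s fixed, then fold every copy onto the copy u′ of a
-- neighbour u of s: what remains is G together with u′, whose only
-- neighbour is s.
module AddLeafX (G : BGraph) (_≟X_ : DecidableEquality (X G)) (_≟Y_ : DecidableEquality (Y G))
                {u s} (us : E G u s) where

  doubled : BGraph
  doubled = double G (λ _ → false) (λ y → ⌊ y ≟Y s ⌋)

  keepX : X doubled → Bool
  keepX (inj₁ _)       = true
  keepX (inj₂ (x , _)) = ⌊ x ≟X u ⌋

  keepY : Y doubled → Bool
  keepY (inj₁ _) = true
  keepY (inj₂ _) = false

  fold : Hom doubled (induced doubled keepX keepY)
  fold = record { hX = foldX ; hY = foldY ; hE = foldE }
    where
    foldX : X doubled → X (induced doubled keepX keepY)
    foldX (inj₁ x) = inj₁ x , tt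
    foldX (inj₂ _) = inj₂ (u , tt) , fromWitness refl
    foldY : Y doubled → Y (induced doubled keepX keepY)
    foldY (inj₁ y) = inj₁ y , tt
    foldY (inj₂ _) = inj₁ s , tt
    foldE : ∀ x y → E doubled x y → E (induced doubled keepX keepY) (foldX x) (foldY y)
    foldE (inj₁ _) (inj₁ _) e = e
    foldE (inj₁ _) (inj₂ _) (_ , ())
    foldE (inj₂ _) (inj₁ _) (_ , y≟s) with toWitness y≟s
    ... | refl = us , y≟s
    foldE (inj₂ _) (inj₂ _) _ = us , fromWitness refl

  retraction : Retraction doubled keepX keepY
  retraction = fold , fixX , fixY
    where
    fixX : ∀ x → T (keepX x) → proj₁ (hX fold x) ≡ x
    fixX (inj₁ _) _ = refl
    fixX (inj₂ (_ , tt)) x≟u with toWitness x≟u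
    ... | refl = refl
    fixY : ∀ y → T (keepY y) → proj₁ (hY fold y) ≡ y
    fixY (inj₁ _) _ = refl

  collapsed≅addLeafX : Iso (induced doubled keepX keepY) (addLeafX G s)
  collapsed≅addLeafX = record
    { fX = mk↔ₛ′ toX fromX (λ { (just _) → refl ; nothing → refl }) fromX∘toX
    ; fY = mk↔ₛ′ toY (λ y → inj₁ y , tt) (λ _ → refl) λ { (inj₁ _ , tt) → refl }
    ; edge⇒ = edge⇒ ; edge⇐ = edge⇐ }
    where
    toX : X (induced doubled keepX keepY) → Maybe (X G)
    toX (inj₁ x , _) = just x
    toX (inj₂ _ , _) = nothing
    fromX : Maybe (X G) → X (induced doubled keepX keepY)
    fromX (just x) = inj₁ x , tt
    fromX nothing  = inj₂ (u , tt) , fromWitness refl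
    fromX∘toX : ∀ x → fromX (toX x) ≡ x
    fromX∘toX (inj₁ _ , tt) = refl
    fromX∘toX (inj₂ (_ , tt) , x≟u) with toWitness x≟u
    ... | refl = Σ-T-≡ refl
    toY : Y (induced doubled keepX keepY) → Y G
    toY (inj₁ y , _) = y
    edge⇒ : ∀ x y → E (induced doubled keepX keepY) x y → E (addLeafX G s) (toX x) (toY y)
    edge⇒ (inj₁ _ , _) (inj₁ _ , _) e          = e
    edge⇒ (inj₂ _ , _) (inj₁ _ , _) (_ , y≟s) = toWitness y≟s
    edge⇐ : ∀ x y → E (addLeafX G s) (toX x) (toY y) → E (induced doubled keepX keepY) x y
    edge⇐ (inj₁ _ , _) (inj₁ _ , _) e = e
    edge⇐ (inj₂ _ , x≟u) (inj₁ _ , _) refl with toWitness x≟u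
    ... | refl = us , fromWitness refl

constructible-addLeafX : ∀ G → DecidableEquality (X G) → DecidableEquality (Y G) →
                         Constructible G → ∀ {u s} → E G u s → Constructible (addLeafX G s)
constructible-addLeafX G _≟X_ _≟Y_ c us =
  c-rename (c-collapse (c-double c _ _) keepX keepY retraction) collapsed≅addLeafX
  where open AddLeafX G _≟X_ _≟Y_ us

module _ (G : BGraph) (_≟X_ : DecidableEquality (X G)) (_≟Y_ : DecidableEquality (Y G)) where

  addLeafX≅induced-insert :
    ∀ {PX PY w s} (ps : T (PY s)) → ¬ T (PX w) → E G w s → (∀ {y} → T (PY y) → E G w y → y ≡ s) →
    Iso (addLeafX (induced G PX PY) (s , ps)) (induced G (insert _≟X_ w PX) PY)
  addLeafX≅induced-insert {PX} {PY} {w} {s} ps w∉PX ws unique = record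
    { fX = mk↔ₛ′ toX fromX toX∘fromX fromX∘toX
    ; fY = ↔-id _
    ; edge⇒ = λ { nothing _ refl → ws ; (just _) _ e → e }
    ; edge⇐ = λ { nothing (_ , py) e → Σ-T-≡ (unique py e) ; (just _) _ e → e } }
    where
    toX : Maybe (Σ (X G) (T ∘ PX)) → Σ (X G) (T ∘ insert _≟X_ w PX)
    toX nothing        = w , insert-here _≟X_ PX w
    toX (just (x , p)) = x , insert-there _≟X_ PX w p
    fromX : Σ (X G) (T ∘ insert _≟X_ w PX) → Maybe (Σ (X G) (T ∘ PX))
    fromX (x , q) with insert-case _≟X_ PX w q
    ... | inj₁ _ = nothing
    ... | inj₂ p = just (x , p)
    toX∘fromX : ∀ x → toX (fromX x) ≡ x
    toX∘fromX (x , q) with insert-case _≟X_ PX w q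
    ... | inj₁ refl = Σ-T-≡ refl
    ... | inj₂ _    = Σ-T-≡ refl
    fromX∘toX : ∀ x → fromX (toX x) ≡ x
    fromX∘toX nothing with insert-case _≟X_ PX w (insert-here _≟X_ PX w)
    ... | inj₁ _ = refl
    ... | inj₂ p = ⊥-elim (w∉PX p)
    fromX∘toX (just (x , p)) with insert-case _≟X_ PX w (insert-there _≟X_ PX w p)
    ... | inj₁ refl = ⊥-elim (w∉PX p)
    ... | inj₂ _    = cong just (Σ-T-≡ refl)

  constructible-insertX :
    ∀ {PX PY} → Constructible (induced G PX PY) →
    ∀ {u s w} → T (PX u) → T (PY s) → ¬ T (PX w) → E G u s → E G w s →
    (∀ {y} → T (PY y) → E G w y → y ≡ s) →
    Constructible (induced G (insert _≟X_ w PX) PY)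
  constructible-insertX c pu ps w∉PX us ws unique =
    c-rename (constructible-addLeafX _ (Σ-T-≟ _≟X_) (Σ-T-≟ _≟Y_) c {_ , pu} {_ , ps} us)
             (addLeafX≅induced-insert ps w∉PX ws unique)

constructible-insertY :
  ∀ G (_≟X_ : DecidableEquality (X G)) (_≟Y_ : DecidableEquality (Y G)) {PX PY} →
  Constructible (induced G PX PY) →
  ∀ {u s w} → T (PY u) → T (PX s) → ¬ T (PY w) → E G s u → E G s w →
  (∀ {x} → T (PX x) → E G x w → x ≡ s) →
  Constructible (induced G PX (insert _≟Y_ w PY))
constructible-insertY G _≟X_ _≟Y_ c pu ps w∉PY su sw unique =
  constructible-transpose
    (constructible-insertX (transpose G) _≟Y_ _≟X_ (constructible-transpose c) pu ps w∉PY su sw unique)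

singleEdge≅induced : ∀ G {PX PY a b} → T (PX a) → T (PY b) →
                     (∀ {x} → T (PX x) → x ≡ a) → (∀ {y} → T (PY y) → y ≡ b) → E G a b →
                     Iso singleEdge (induced G PX PY)
singleEdge≅induced G {a = a} {b} pa pb onlyA onlyB ab = record
  { fX = mk↔ₛ′ (λ _ → a , pa) _ (λ (_ , p) → Σ-T-≡ (sym (onlyA p))) (λ _ → refl)
  ; fY = mk↔ₛ′ (λ _ → b , pb) _ (λ (_ , p) → Σ-T-≡ (sym (onlyB p))) (λ _ → refl)
  ; edge⇒ = λ _ _ _ → ab ; edge⇐ = _ }

induced-full≅ : ∀ G {PX PY} → (∀ x → T (PX x)) → (∀ y → T (PY y)) → Iso (induced G PX PY) G
induced-full≅ G allX allY = record
  { fX = mk↔ₛ′ proj₁ (λ x → x , allX x) (λ _ → refl) (λ _ → Σ-T-≡ refl)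
  ; fY = mk↔ₛ′ proj₁ (λ y → y , allY y) (λ _ → refl) (λ _ → Σ-T-≡ refl)
  ; edge⇒ = λ _ _ e → e ; edge⇐ = λ _ _ e → e }

lookup-injective : ∀ {A : Set} {xs : List A} → Unique xs → ∀ {i j} → lookup xs i ≡ lookup xs j → i ≡ j
lookup-injective (_ ∷ _) {zero}  {zero}  _  = refl
lookup-injective (x∉ ∷ _) {zero}  {suc j} eq = ⊥-elim (All.lookup x∉ (∈-lookup j) eq)
lookup-injective (x∉ ∷ _) {suc i} {zero}  eq = ⊥-elim (All.lookup x∉ (∈-lookup i) (sym eq))
lookup-injective (_ ∷ u) {suc i} {suc j} eq = cong suc (lookup-injective u eq)

module _ {m k : ℕ} (E : Fin m → Fin k → Bool) where

  private
    V : Set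
    V = Vtx m k

  _≟V_ : DecidableEquality V
  _≟V_ = ≡-dec Fin._≟_ Fin._≟_

  Adj-sym : ∀ a b → Adj E a b → Adj E b a
  Adj-sym (inj₁ _) (inj₂ _) e = e
  Adj-sym (inj₂ _) (inj₁ _) e = e

  spanned : (V → Bool) → BGraph
  spanned S = induced (toBGraph m k E) (S ∘ inj₁) (S ∘ inj₂)

  data Walk : V → V → List V → Set where
    []  : ∀ {a} → Walk a a []
    _∷_ : ∀ {a b c vs} → Adj E a b → Walk b c vs → Walk a c (b ∷ vs)

  walk-snoc : ∀ {a b c vs} → Walk a b vs → Adj E b c → Walk a c (vs ++ [ c ])
  walk-snoc []      bc = bc ∷ []
  walk-snoc (e ∷ w) bc = e ∷ walk-snoc w bc

  walk-adjacent : ∀ {a b vs} → Walk a b vs → ∀ i → Adj E (lookup (a ∷ vs) (inject₁ i)) (lookup vs i)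
  walk-adjacent (e ∷ _) zero    = e
  walk-adjacent (_ ∷ w) (suc i) = walk-adjacent w i

  walk-last : ∀ {a b vs} → Walk a b vs → lookup (a ∷ vs) (fromℕ (length vs)) ≡ b
  walk-last []      = refl
  walk-last (_ ∷ w) = walk-last w

  closed-walk-cycle : ∀ {a b v₁ v₂ vs} → Walk a b (v₁ ∷ v₂ ∷ vs) → Unique (a ∷ v₁ ∷ v₂ ∷ vs) →
                      Adj E b a → HasCycle E
  closed-walk-cycle {a} {v₁ = v₁} {v₂} {vs} w u ba =
    length vs , lookup (a ∷ v₁ ∷ v₂ ∷ vs) , lookup-injective u , walk-adjacent w ,
    subst (λ v → Adj E v a) (sym (walk-last w)) ba

  record SimplePathIn (S : V → Bool) (a b : V) : Set where
    constructor simplePath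
    field
      vertices : List V
      walk     : Walk a b vertices
      unique   : Unique (a ∷ vertices)
      inside   : All (T ∘ S) (a ∷ vertices)

  simplePath-mono : ∀ {S S′ a b} → T ∘ S ⊆ T ∘ S′ → SimplePathIn S a b → SimplePathIn S′ a b
  simplePath-mono sub (simplePath vs w u i) = simplePath vs w u (All.map sub i)

  simplePath-refl : ∀ {S a} → T (S a) → SimplePathIn S a a
  simplePath-refl a∈S = simplePath [] [] ([] ∷ []) (a∈S ∷ [])

  simplePath-edge : ∀ {S a b} → T (S a) → T (S b) → a ≢ b → Adj E a b → SimplePathIn S a b
  simplePath-edge a∈S b∈S a≢b ab = simplePath [ _ ] (ab ∷ []) ((a≢b ∷ []) ∷ [] ∷ []) (a∈S ∷ b∈S ∷ [])

  outside-≢ : ∀ {S : V → Bool} {w v} → ¬ T (S w) → T (S v) → w ≢ v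
  outside-≢ w∉S v∈S refl = w∉S v∈S

  record ConstructibleSubtree (S : V → Bool) : Set₁ where
    field
      neighbour     : ∀ {a} → T (S a) → ∃ λ b → T (S b) × Adj E a b
      path          : ∀ {a b} → T (S a) → T (S b) → SimplePathIn S a b
      constructible : Constructible (spanned S)
  open ConstructibleSubtree

  module _ (acyclic : ¬ HasCycle E) where

    neighbour-unique : ∀ {S w s₁ s₂} → ConstructibleSubtree S → ¬ T (S w) → T (S s₁) → T (S s₂) →
                       Adj E s₁ w → Adj E s₂ w → s₁ ≡ s₂
    neighbour-unique {w = w} {s₁} t w∉S p₁ p₂ e₁ e₂ with path t p₁ p₂
    ... | simplePath [] [] _ _ = refl
    ... | simplePath (_ ∷ _) p u i =
      ⊥-elim (acyclic (closed-walk-cycle (Adj-sym s₁ w e₁ ∷ p) (All.map (outside-≢ w∉S) i ∷ u) e₂))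

    extend-path : ∀ {S s w} → ConstructibleSubtree S → T (S s) → ¬ T (S w) → Adj E s w →
                  ∀ {a b} → T (insert _≟V_ w S a) → T (insert _≟V_ w S b) →
                  SimplePathIn (insert _≟V_ w S) a b
    extend-path {S} {s} {w} t s∈S w∉S sw a∈ b∈
      with insert-case _≟V_ S w a∈ | insert-case _≟V_ S w b∈
    ... | inj₁ refl | inj₁ refl = simplePath-refl (insert-here _≟V_ S w)
    ... | inj₁ refl | inj₂ b∈S with path t s∈S b∈S
    ...   | simplePath vs p u i =
      simplePath (s ∷ vs) (Adj-sym s w sw ∷ p) (All.map (outside-≢ w∉S) i ∷ u)
                 (insert-here _≟V_ S w ∷ All.map (insert-there _≟V_ S w) i)
    extend-path {S} {s} {w} t s∈S w∉S sw a∈ b∈ | inj₂ a∈S | inj₁ refl with path t a∈S s∈S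
    ...   | simplePath vs p u i =
      simplePath (vs ++ [ w ]) (walk-snoc p sw)
                 (AllPairs.++⁺ u ([] ∷ []) (All.map (λ v∈S → (outside-≢ w∉S v∈S ∘ sym) ∷ []) i))
                 (All.++⁺ (All.map (insert-there _≟V_ S w) i) (insert-here _≟V_ S w ∷ []))
    extend-path {S} {s} {w} t s∈S w∉S sw a∈ b∈ | inj₂ a∈S | inj₂ b∈S =
      simplePath-mono (insert-there _≟V_ S w) (path t a∈S b∈S)

    extend-constructible : ∀ {S s w} → ConstructibleSubtree S → T (S s) → ¬ T (S w) → Adj E s w →
                           Constructible (spanned (insert _≟V_ w S))
    extend-constructible {S} {inj₂ s} {inj₁ w} t s∈S w∉S sw with neighbour t s∈S
    ... | inj₁ u , u∈S , su =
      constructible-insertX (toBGraph m k E) Fin._≟_ Fin._≟_ (constructible t) u∈S s∈S w∉S su sw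
        (λ y∈S wy → inj₂-injective (neighbour-unique {s₁ = inj₂ _} t w∉S y∈S s∈S wy sw))
    extend-constructible {S} {inj₁ s} {inj₂ w} t s∈S w∉S sw with neighbour t s∈S
    ... | inj₂ u , u∈S , su =
      constructible-insertY (toBGraph m k E) Fin._≟_ Fin._≟_ (constructible t) u∈S s∈S w∉S su sw
        (λ x∈S xw → inj₁-injective (neighbour-unique {s₁ = inj₁ _} t w∉S x∈S s∈S xw sw))

    extend : ∀ {S s w} → ConstructibleSubtree S → T (S s) → ¬ T (S w) → Adj E s w → ConstructibleSubtree (insert _≟V_ w S)
    extend {S} {s} {w} t s∈S w∉S sw = record
      { neighbour = extend-neighbour
      ; path = extend-path t s∈S w∉S sw
      ; constructible = extend-constructible t s∈S w∉S sw }
      where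
      extend-neighbour : ∀ {a} → T (insert _≟V_ w S a) → ∃ λ b → T (insert _≟V_ w S b) × Adj E a b
      extend-neighbour a∈ with insert-case _≟V_ S w a∈
      ... | inj₁ refl = s , insert-there _≟V_ S w s∈S , Adj-sym s w sw
      ... | inj₂ a∈S with neighbour t a∈S
      ...   | b , b∈S , ab = b , insert-there _≟V_ S w b∈S , ab

    absorb-walk : ∀ {S a b} → ConstructibleSubtree S → T (S a) → Star (Adj E) a b →
                  ∃ λ S′ → ConstructibleSubtree S′ × T ∘ S ⊆ T ∘ S′ × T (S′ b)
    absorb-walk t a∈S ε = _ , t , id , a∈S
    absorb-walk {S} t a∈S (_◅_ {j = a′} aa′ rest) with T? (S a′)
    ... | yes a′∈S = absorb-walk t a′∈S rest
    ... | no a′∉S with absorb-walk (extend t a∈S a′∉S aa′) (insert-here _≟V_ S a′) rest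
    ...   | S′ , t′ , sub , b∈S′ = S′ , t′ , (λ v∈S → sub (insert-there _≟V_ S a′ v∈S)) , b∈S′

    absorb-all : ∀ {S r} → Connected E → ConstructibleSubtree S → T (S r) → (vs : List V) →
                 ∃ λ S′ → ConstructibleSubtree S′ × T ∘ S ⊆ T ∘ S′ × All (T ∘ S′) vs
    absorb-all connected t r∈S [] = _ , t , id , []
    absorb-all {r = r} connected t r∈S (v ∷ vs) with absorb-all connected t r∈S vs
    ... | S₁ , t₁ , sub₁ , vs∈S₁ with absorb-walk t₁ (sub₁ r∈S) (connected r v)
    ...   | S₂ , t₂ , sub₂ , v∈S₂ = S₂ , t₂ , sub₂ ∘ sub₁ , v∈S₂ ∷ All.map sub₂ vs∈S₁

  vertices : List V
  vertices = map inj₁ (allFin m) ++ map inj₂ (allFin k)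

  ∈-vertices : ∀ v → v ∈ vertices
  ∈-vertices (inj₁ x) = ∈-++⁺ˡ (∈-map⁺ inj₁ (∈-allFin x))
  ∈-vertices (inj₂ y) = ∈-++⁺ʳ _ (∈-map⁺ inj₂ (∈-allFin y))

  endpoints : Fin m → Fin k → V → Bool
  endpoints x₀ y₀ (inj₁ x) = ⌊ x Fin.≟ x₀ ⌋
  endpoints x₀ y₀ (inj₂ y) = ⌊ y Fin.≟ y₀ ⌋

  edgeSubtree : ∀ {x₀ y₀} → T (E x₀ y₀) → ConstructibleSubtree (endpoints x₀ y₀)
  edgeSubtree {x₀} {y₀} x₀y₀ = record
    { neighbour = λ {a} → neighbour₀ {a}
    ; path = λ {a b} → path₀ {a} {b}
    ; constructible = c-rename c-edge
        (singleEdge≅induced _ (fromWitness refl) (fromWitness refl) toWitness toWitness x₀y₀) }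
    where
    neighbour₀ : ∀ {a} → T (endpoints x₀ y₀ a) → ∃ λ b → T (endpoints x₀ y₀ b) × Adj E a b
    neighbour₀ {inj₁ _} x∈ with toWitness x∈
    ... | refl = inj₂ y₀ , fromWitness refl , x₀y₀
    neighbour₀ {inj₂ _} y∈ with toWitness y∈
    ... | refl = inj₁ x₀ , fromWitness refl , x₀y₀
    path₀ : ∀ {a b} → T (endpoints x₀ y₀ a) → T (endpoints x₀ y₀ b) → SimplePathIn (endpoints x₀ y₀) a b
    path₀ {inj₁ _} {inj₁ _} a∈ b∈ with toWitness a∈ | toWitness b∈
    ... | refl | refl = simplePath-refl a∈
    path₀ {inj₁ _} {inj₂ _} a∈ b∈ with toWitness a∈ | toWitness b∈
    ... | refl | refl = simplePath-edge a∈ b∈ (λ ()) x₀y₀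
    path₀ {inj₂ _} {inj₁ _} a∈ b∈ with toWitness a∈ | toWitness b∈
    ... | refl | refl = simplePath-edge a∈ b∈ (λ ()) x₀y₀
    path₀ {inj₂ _} {inj₂ _} a∈ b∈ with toWitness a∈ | toWitness b∈
    ... | refl | refl = simplePath-refl a∈

  spanning : ¬ HasCycle E → Connected E → ∀ {x₀ y₀} → T (E x₀ y₀) →
             ∃ λ S → ConstructibleSubtree S × (∀ v → T (S v))
  spanning acyclic connected {x₀} x₀y₀
    with absorb-all acyclic {r = inj₁ x₀} connected (edgeSubtree x₀y₀) (fromWitness refl) vertices
  ... | S , t , _ , all = S , t , λ v → All.lookup all (∈-vertices v)

theorem7p3 : (m k : ℕ) (E : Fin m → Fin k → Bool) →
    IsTree E → HasEdge E → Constructible (toBGraph m k E)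
theorem7p3 m k E (connected , acyclic) (_ , _ , x₀y₀) with spanning E acyclic connected x₀y₀
... | S , t , full = c-rename (ConstructibleSubtree.constructible t) (induced-full≅ _ (full ∘ inj₁) (full ∘ inj₂))
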